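{- Let $K_{m_1,\ldots,m_k}$ be a complete multipartite graph with $k\ge 2$, $1\le m_1\le m_2\le\cdots\le m_k$ and $m_k\ge 2$, and let $V$ be its vertex set. Let $\lambda:=|\{i\mid m_i\ge 2\}|$ and suppose $\lambda\ge 2$. Let $d:=m_k-\sum_{i=1}^{k-1}(m_i-1)$. Then \[ \operatorname{nim}(\mathrm{TER}(K_{m_1,\ldots,m_k}))=\begin{cases} 0, & |V| \text{ even and } d \leq 1 \\ 1, & |V| \text{ even and } 2 \leq d \\ 1, & |V| \text{ odd and } d \leq 0 \\ 2, & |V| \text{ odd and } d \in \{1, 2\} \\ 0, & |V| \text{ odd and } 3 \leq d. \end{cases} \]
   Context: For a graph $G$ with vertex set $V$, a set $K\subseteq V$ is convex if it contains every vertex lying on any shortest path between two elements of $K$. The convex hull $[P]$ of $P\subseteq V$ is the smallest convex set containing $P$. The game $\mathrm{TER}(G)$: positions are the sets $P\subseteq V$ reachable from the starting position $\emptyset$ by the following moves. If $[V\setminus P]=V$, then the options of $P$ are all sets $P\cup\{v\}$ with $v\in V\setminus P$; if $[V\setminus P]\neq V$, then $P$ is terminal (has no options). The nim-value of a position is defined recursively by $\operatorname{nim}(p)=\operatorname{mex}\{\operatorname{nim}(q): q\text{ an option of }p\}$, where $\operatorname{mex}(A)$ is the smallest nonnegative integer not in $A$; the nim-value of a game is that of its starting position. -}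

module Defs where

open import Level using (Level; _⊔_; 0ℓ) renaming (suc to lsuc)
open import Data.Fin.Base as Fin using (Fin; zero; suc)
open import Data.Fin.Properties using (+↔⊎)
open import Data.Integer.Base as ℤ using (ℤ; +_; 0ℤ; 1ℤ)
open import Data.List.Base as List using (List; []; _∷_)
open import Data.List.Membership.Propositional using () renaming (_∈_ to _∈ˡ_)
open import Data.List.Relation.Unary.Unique.Propositional using (Unique)
open import Data.Nat.Base as ℕ using (ℕ; zero; suc; _≤_)
open import Data.Nat.Properties as ℕ using (_≤?_)
open import Data.Product.Base using (Σ; Σ-syntax; ∃-syntax; _×_; _,_; proj₁; proj₂)
open import Data.Sum.Base using (_⊎_; inj₁; inj₂)
open import Data.Sum.Function.Propositional using (_⊎-↔_)
open import Data.Vec.Base as Vec using ()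
open import Data.Vec.Functional using (Vector; init; last; tail)
open import Function.Base using (_∘_; _on_)
open import Function.Bundles using (_↔_; mk↔ₛ′)
open import Function.Construct.Composition using (_↔-∘_)
open import Function.Construct.Identity using (↔-id)
open import Function.Construct.Symmetry using (↔-sym)
open import Relation.Binary.Construct.Closure.ReflexiveTransitive using (Star; ε; _◅_)
open import Relation.Binary.Core using (Rel)
open import Relation.Binary.Definitions using (Symmetric; Irreflexive)
open import Relation.Binary.PropositionalEquality using (_≡_; refl; sym; trans; _≢_; ≢-sym)
open import Relation.Unary using (Pred; ∅; ∁; _∪_; ｛_｝; _∈_; _∉_; _⊆_; Universal)

import Algebra.Definitions.RawMonoid ℕ.+-0-rawMonoid as ℕΣ
import Algebra.Definitions.RawMonoid ℤ.+-0-rawMonoid as ℤΣ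

private
  variable
    a ℓ : Level

record Graph : Set₁ where
  field
    V      : Set
    Adj    : Rel V 0ℓ
    symm   : Symmetric Adj
    irrefl : Irreflexive _≡_ Adj

module _ (G : Graph) where
  open Graph G

  Walk : Rel V 0ℓ
  Walk = Star Adj

  vertices : ∀ {x y} → Walk x y → List V
  vertices {x} ε       = x ∷ []
  vertices {x} (_ ◅ w) = x ∷ vertices w

  edgeCount : ∀ {x y} → Walk x y → ℕ
  edgeCount ε       = 0
  edgeCount (_ ◅ w) = suc (edgeCount w)

  IsPath : ∀ {x y} → Walk x y → Set
  IsPath w = Unique (vertices w)

  IsShortestPath : ∀ {x y} → Walk x y → Set
  IsShortestPath {x} {y} w =
    IsPath w × (∀ (u : Walk x y) → IsPath u → edgeCount w ≤ edgeCount u)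

  Convex : Pred V 0ℓ → Set
  Convex K = ∀ {x y} → x ∈ K → y ∈ K →
             ∀ (w : Walk x y) → IsShortestPath w →
             ∀ {v} → v ∈ˡ vertices w → v ∈ K

  -- The smallest convex superset, as the intersection of all of them.
  Hull : Pred V 0ℓ → Pred V (lsuc 0ℓ)
  Hull P v = ∀ (K : Pred V 0ℓ) → Convex K → P ⊆ K → v ∈ K

-- p ⟶ q means that q is an option of p.
record Game a ℓ : Set (lsuc (a ⊔ ℓ)) where
  infix 4 _⟶_
  field
    Position : Set a
    start    : Position
    _⟶_      : Rel Position ℓ

IsMex : Pred ℕ ℓ → ℕ → Set ℓ
IsMex A n = n ∉ A × (∀ {j} → j ∉ A → n ≤ j)

module _ (Γ : Game a ℓ) where
  open Game Γ

  -- The recursion nim(p) = mex {nim(q) : p ⟶ q}, presented through its graph: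
  -- nim(p) = n once every option q has been given its nim-value.  Being
  -- inductive, it assigns values only where the recursion terminates, and it
  -- needs no decision procedure for the options; val may use the proof of
  -- p ⟶ q, but by HasNim-unique its result depends on q alone.
  data HasNim (p : Position) : ℕ → Set (a ⊔ ℓ) where
    mexOptions : ∀ {n}
      (val : ∀ {q} → p ⟶ q → ℕ) →
      (∀ {q} (o : p ⟶ q) → HasNim q (val o)) →
      IsMex (λ j → ∃[ q ] Σ[ o ∈ p ⟶ q ] val {q} o ≡ j) n →
      HasNim p n

  HasNim-unique : ∀ {p m n} → HasNim p m → HasNim p n → m ≡ n
  HasNim-unique (mexOptions f hf (m∉ , m≤)) (mexOptions g hg (n∉ , n≤)) =
    ℕ.≤-antisym
      (m≤ λ (q , o , e) → n∉ (q , o , trans (sym (HasNim-unique (hf o) (hg o))) e))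
      (n≤ λ (q , o , e) → m∉ (q , o , trans (HasNim-unique (hf o) (hg o)) e))

  GameHasNim : ℕ → Set (a ⊔ ℓ)
  GameHasNim = HasNim start

module _ (G : Graph) where
  open Graph G

  TERMove : Rel (Pred V 0ℓ) (lsuc 0ℓ)
  TERMove P Q = Universal (Hull G (∁ P)) × ∃[ v ] (v ∉ P × Q ≡ P ∪ ｛ v ｝)

  TER : Game (lsuc 0ℓ) (lsuc 0ℓ)
  TER = record
    { Position = ∃[ P ] Star TERMove ∅ P
    ; start    = ∅ , ε
    ; _⟶_      = TERMove on proj₁
    }

-- m lists the part sizes; the vertex (i , j) is the j-th vertex of part i.
completeMultipartite : ∀ {k} → Vector ℕ k → Graph
completeMultipartite {k} m = record
  { V      = Σ[ i ∈ Fin k ] Fin (m i)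
  ; Adj    = _≢_ on proj₁
  ; symm   = ≢-sym
  ; irrefl = λ { refl i≢i → i≢i refl }
  }

order : ∀ {k} → Vector ℕ k → ℕ
order = ℕΣ.sum

order-correct : ∀ {k} (m : Vector ℕ k) →
                Fin (order m) ↔ Graph.V (completeMultipartite m)
order-correct {zero}  m = mk↔ₛ′ (λ ()) (λ ()) (λ ()) (λ ())
order-correct {suc k} m =
  split ↔-∘ ((↔-id _ ⊎-↔ order-correct (tail m)) ↔-∘ +↔⊎)
  where
  split : (Fin (m zero) ⊎ Σ[ i ∈ Fin k ] Fin (tail m i)) ↔ (Σ[ i ∈ Fin (suc k) ] Fin (m i))
  split = mk↔ₛ′
    (λ { (inj₁ j) → zero , j ; (inj₂ (i , j)) → suc i , j })
    (λ { (zero , j) → inj₁ j ; (suc i , j) → inj₂ (i , j) })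
    (λ { (zero , j) → refl ; (suc i , j) → refl })
    (λ { (inj₁ j) → refl ; (inj₂ (i , j)) → refl })

Nondecreasing : ∀ {k} → Vector ℕ k → Set
Nondecreasing m = ∀ {i j} → i Fin.≤ j → m i ≤ m j

nontrivialParts : ∀ {k} → Vector ℕ k → ℕ
nontrivialParts m = Vec.count (2 ≤?_) (Vec.tabulate m)

excess : ∀ {k} → Vector ℕ (suc k) → ℤ
excess m = + last m ℤ.- ℤΣ.sum (λ i → + init m i ℤ.- 1ℤ)

-- A vertex set generates the whole graph as soon as it contains two vertices of
-- one part: together they generate every other part, one of which is again
-- nontrivial because λ ≥ 2.  A set without such a pair is a clique, hence
-- convex.  So TER is the game of removing one token at a time from heaps of
-- sizes m₁, …, m_k, ending once no heap has two tokens.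
--
-- The stated value remains correct at every unfinished position of that game,
-- when d is computed from the largest heap and the other nonempty heaps: a move
-- flips the parity of the total and changes d by at most 1, so no option repeats
-- the value, while a suitable move realises each smaller one.

module Submission where

open import Defs
open import Data.Nat.Base using (ℕ; suc; _≤_)
open import Data.Nat.Divisibility using (_∣_; _∤_)
open import Data.Integer.Base using (+_) renaming (_≤_ to _≤ℤ_)
open import Data.Product.Base using (_×_)
open import Data.Sum.Base using (_⊎_)
open import Data.Vec.Functional using (Vector; head; last)
open import Relation.Binary.PropositionalEquality using (_≡_)

open import Level using (0ℓ)
open import Data.Bool.Base using (if_then_else_; false; _∨_)
open import Data.Bool.Properties using (∨-identityʳ; ∨-zeroʳ)
open import Data.Empty using (⊥)
open import Data.Fin.Base using (Fin; zero; suc; punchIn; punchOut; fromℕ)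
open import Data.Fin.Properties using (any?; punchInᵢ≢i; punchIn-punchOut; ≤fromℕ) renaming (_≟_ to _≟ᶠ_; suc-injective to suc-injectiveᶠ)
open import Data.Integer.Base as ℤ using (1ℤ)
import Data.Integer.Properties as ℤ
open import Data.List.Membership.Propositional using () renaming (_∈_ to _∈ˡ_)
open import Data.List.Relation.Unary.All using () renaming ([] to []ᴬ; _∷_ to _∷ᴬ_)
open import Data.List.Relation.Unary.AllPairs using () renaming ([] to []ᴾ; _∷_ to _∷ᴾ_)
open import Data.List.Relation.Unary.Any using (here; there)
open import Data.Nat.Base as ℕ using (zero; _+_; _∸_; _⊔_; _<_; pred; z≤n; s≤s; s≤s⁻¹; ≢-nonZero)
open import Data.Nat.Divisibility using (_∣?_; divides; ∣-refl; ∣1⇒≡1; ∣m+n∣m⇒∣n; ∣m∣n⇒∣m+n; _∣0)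
open import Data.Nat.Properties
open import Data.Product.Base using (∃; ∃-syntax; Σ-syntax; _,_; proj₁; proj₂)
open import Data.Product.Properties using (≡-dec)
open import Data.Sum.Base using (inj₁; inj₂)
open import Data.Vec.Base as Vec using ()
open import Data.Vec.Functional using (foldr; tail; init; removeAt)
open import Function.Base using (_∘_)
open import Relation.Binary.Construct.Closure.ReflexiveTransitive using (Star; ε; _◅_; _◅◅_)
open import Relation.Binary.PropositionalEquality using (refl; sym; trans; cong; cong₂; subst; subst₂; _≢_; module ≡-Reasoning)
open import Relation.Nullary using (¬_; ¬?; _×-dec_; Dec; yes; no; contradiction; does; from-no)
open import Relation.Nullary.Decidable using (dec-true; dec-false)
open import Relation.Unary using (Pred; Decidable; ∅; ∁; _∪_; ｛_｝; _∈_; _∉_; Universal)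
open import Relation.Unary.Properties using (∅?; _∪?_)

open import Algebra.Properties.CommutativeMonoid.Sum +-0-commutativeMonoid using (sum; sum-remove; sum-cong-≗; sum-init-last)
import Algebra.Properties.Monoid.Sum ℤ.+-0-monoid as ℤΣ

private
  variable
    k n : ℕ

-- Finite sums, maxima and parity.

positive-summand : (x : Vector ℕ n) → sum x ≢ 0 → ∃[ j ] x j ≢ 0
positive-summand {n = zero}  x Σ≢0 = contradiction refl Σ≢0
positive-summand {n = suc n} x Σ≢0 with x zero in eq
... | suc a = zero , λ x₀≡0 → contradiction (trans (sym eq) x₀≡0) λ ()
... | zero with positive-summand (tail x) Σ≢0
...   | j , xⱼ≢0 = suc j , xⱼ≢0

summand≤sum : (x : Vector ℕ n) (j : Fin n) → x j ≤ sum x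
summand≤sum x zero    = m≤m+n _ _
summand≤sum x (suc j) = ≤-trans (summand≤sum (tail x) j) (m≤n+m _ _)

sum-pred≤sum : (x : Vector ℕ n) → sum (pred ∘ x) ≤ sum x
sum-pred≤sum {n = zero}  x = z≤n
sum-pred≤sum {n = suc n} x = +-mono-≤ pred[n]≤n (sum-pred≤sum (tail x))

-- Exposing the common remainder `r` lets a change of one entry be carried over to the sum by
-- rewriting.
sums-agreeing-off : (x y : Vector ℕ n) (i : Fin n) → (∀ j → j ≢ i → x j ≡ y j) →
                    ∃[ r ] sum x ≡ x i + r × sum y ≡ y i + r
sums-agreeing-off {n = suc n} x y i agree =
  sum (removeAt x i) , sum-remove x ,
  trans (sum-remove y)
    (cong (y i ℕ.+_) (sum-cong-≗ λ j → sym (agree (punchIn i j) (punchInᵢ≢i i j))))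

maximum : Vector ℕ n → ℕ
maximum = foldr _⊔_ 0

≤maximum : (u : Vector ℕ n) (i : Fin n) → u i ≤ maximum u
≤maximum u zero    = m≤m⊔n _ _
≤maximum u (suc i) = ≤-trans (≤maximum (tail u) i) (m≤n⊔m _ _)

maximum-least : (u : Vector ℕ n) {b : ℕ} → (∀ i → u i ≤ b) → maximum u ≤ b
maximum-least {n = zero}  u u≤b = z≤n
maximum-least {n = suc n} u u≤b = ⊔-lub (u≤b zero) (maximum-least (tail u) (u≤b ∘ suc))

maximum-attained : (u : Vector ℕ (suc k)) → ∃[ c ] u c ≡ maximum u
maximum-attained {k = zero}  u = zero , sym (⊔-identityʳ _)
maximum-attained {k = suc k} u with maximum-attained (tail u) | ⊔-sel (u zero) (maximum (tail u))
... | c , eq | inj₁ max≡head = zero , sym max≡head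
... | c , eq | inj₂ max≡tail = suc c , trans eq (sym max≡tail)

2∣n⇒2∤1+n : 2 ∣ n → 2 ∤ suc n
2∣n⇒2∤1+n {n} 2∣n 2∣1+n =
  contradiction (∣1⇒≡1 (∣m+n∣m⇒∣n (subst (2 ∣_) (+-comm 1 n) 2∣1+n) 2∣n)) λ ()

2∤n⇒2∣1+n : ∀ n → 2 ∤ n → 2 ∣ suc n
2∤n⇒2∣1+n zero          2∤n = contradiction (2 ∣0) 2∤n
2∤n⇒2∣1+n (suc zero)    2∤n = ∣-refl
2∤n⇒2∣1+n (suc (suc n)) 2∤n =
  ∣m∣n⇒∣m+n ∣-refl (2∤n⇒2∣1+n n (2∤n ∘ ∣m∣n⇒∣m+n ∣-refl))

2∣n+n : ∀ n → 2 ∣ n + n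
2∣n+n n = divides n (trans (cong (n ℕ.+_) (sym (+-identityʳ n))) (*-comm 2 n))

-- The value of a heap position in terms of T, M and E.

-- For a position of the heap game with sizes u, T stands for their sum, M for
-- the largest and E for Σ (uᵢ − 1) over the other nonempty heaps, so that
-- d = M − E; every condition on d is written additively.
data NimValue (T M E : ℕ) : ℕ → Set where
  settled   : M ≤ 1 → NimValue T M E 0
  even-low  : 2 ≤ M → 2 ∣ T → M ≤ 1 + E → NimValue T M E 0
  even-high : 2 ≤ M → 2 ∣ T → 2 + E ≤ M → NimValue T M E 1
  odd-low   : 2 ≤ M → 2 ∤ T → M ≤ E → NimValue T M E 1
  odd-mid   : 2 ≤ M → 2 ∤ T → 1 + E ≤ M → M ≤ 2 + E → NimValue T M E 2
  odd-high  : 2 ≤ M → 2 ∤ T → 3 + E ≤ M → NimValue T M E 0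

nimValue : ∀ T M E → ∃ (NimValue T M E)
nimValue T M E with M ≤? 1
... | yes M≤1 = 0 , settled M≤1
... | no  M≰1 with 2 ∣? T
...   | yes 2∣T with M ≤? 1 + E
...     | yes low = 0 , even-low (≰⇒> M≰1) 2∣T low
...     | no  high = 1 , even-high (≰⇒> M≰1) 2∣T (≰⇒> high)
nimValue T M E | no M≰1 | no 2∤T with M ≤? E
...     | yes low = 1 , odd-low (≰⇒> M≰1) 2∤T low
...     | no  low≰ with M ≤? 2 + E
...       | yes mid = 2 , odd-mid (≰⇒> M≰1) 2∤T (≰⇒> low≰) mid
...       | no  high = 0 , odd-high (≰⇒> M≰1) 2∤T (≰⇒> high)

-- The possible effects of one removal, primes marking the position after it: a singleton vanishes,
-- a token leaves some heap while the maximum survives, or the only largest heap shrinks.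
-- Accordingly d stays, rises by one or falls by one.
data Shift (M E M′ E′ : ℕ) : Set where
  idle    : M ≡ M′ → E ≡ E′ → Shift M E M′ E′
  other   : M ≡ M′ → E ≡ suc E′ → Shift M E M′ E′
  largest : M ≡ suc M′ → E ≡ E′ → Shift M E M′ E′

module _ {M E M′ E′ : ℕ} where

  -- Of the three cases only `largest` lowers d, and by one.
  shift-lower : Shift M E M′ E′ → ∀ t → suc t + E ≤ M → t + E′ ≤ M′
  shift-lower (idle refl refl)    t le = <⇒≤ le
  shift-lower (other refl refl)   t le =
    ≤-trans (+-monoʳ-≤ t (n≤1+n E′)) (<⇒≤ le)
  shift-lower (largest refl refl) t le = s≤s⁻¹ le

  -- Of the three cases only `other` raises d, and by one.
  shift-upper : Shift M E M′ E′ → ∀ t → M ≤ t + E → M′ ≤ suc t + E′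
  shift-upper (idle refl refl)    t le = m≤n⇒m≤1+n le
  shift-upper (other refl refl)   t le = subst (M′ ≤_) (+-suc t E′) le
  shift-upper (largest refl refl) t le = m≤n⇒m≤1+n (<⇒≤ le)

  -- Passing from `suc T` to `T` flips the parity, so no even or odd case can repeat itself. An even
  -- and an odd case of equal value lie two apart in d, more than one move can bridge. The premise
  -- on `E′` serves moves that finish the game.
  NimValue-avoids : ∀ {T n j} → 2 ≤ M → Shift M E M′ E′ → (M′ ≤ 1 → E′ ≡ 0) →
                    NimValue (suc T) M E n → NimValue T M′ E′ j → j ≢ n
  NimValue-avoids 2≤M s z (settled M≤1) _ _ = <⇒≱ 2≤M M≤1
  NimValue-avoids 2≤M s z (even-low _ _ low) (settled M′≤1) _ =
    settled-not-low s (z M′≤1) M′≤1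
    where
    settled-not-low : Shift M E M′ E′ → E′ ≡ 0 → M′ ≤ 1 → ⊥
    settled-not-low (idle refl refl)    _    M′≤1 = <⇒≱ 2≤M M′≤1
    settled-not-low (other refl refl)   _    M′≤1 = <⇒≱ 2≤M M′≤1
    -- Here E = E′ = 0, so `low` reads M ≤ 1.
    settled-not-low (largest refl refl) refl _    = <⇒≱ 2≤M low
  NimValue-avoids 2≤M s z (even-low _ 2∣T _) (even-low _ 2∣T′ _) _ = 2∣n⇒2∤1+n 2∣T′ 2∣T
  NimValue-avoids 2≤M s z (even-low _ _ low) (odd-high _ _ high) _ =
    <⇒≱ high (shift-upper s 1 low)
  NimValue-avoids 2≤M s z (even-high _ 2∣T _) (even-high _ 2∣T′ _) _ = 2∣n⇒2∤1+n 2∣T′ 2∣T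
  NimValue-avoids 2≤M s z (even-high _ _ high) (odd-low _ _ low) _ =
    <⇒≱ (shift-lower s 1 high) low
  NimValue-avoids 2≤M s z (odd-low _ _ low) (even-high _ _ high) _ =
    <⇒≱ high (shift-upper s 0 low)
  NimValue-avoids 2≤M s z (odd-low _ 2∤T _) (odd-low _ 2∤T′ _) _ = 2∤T (2∤n⇒2∣1+n _ 2∤T′)
  NimValue-avoids 2≤M s z (odd-mid _ 2∤T _ _) (odd-mid _ 2∤T′ _ _) _ =
    2∤T (2∤n⇒2∣1+n _ 2∤T′)
  NimValue-avoids 2≤M s z (odd-high _ _ high) (settled M′≤1) _ =
    <⇒≱ (≤-trans (s≤s (s≤s z≤n)) (shift-lower s 2 high)) M′≤1
  NimValue-avoids 2≤M s z (odd-high _ _ high) (even-low _ _ low) _ =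
    <⇒≱ (shift-lower s 2 high) low
  NimValue-avoids 2≤M s z (odd-high _ 2∤T _) (odd-high _ 2∤T′ _) _ =
    2∤T (2∤n⇒2∣1+n _ 2∤T′)

positive⇒unsettled : ∀ {T M E n j} → NimValue T M E n → j < n → 2 ≤ M
positive⇒unsettled (even-high 2≤M _ _) _ = 2≤M
positive⇒unsettled (odd-low 2≤M _ _)   _ = 2≤M
positive⇒unsettled (odd-mid 2≤M _ _ _) _ = 2≤M

-- Identifies the value that `nimValue` selects with one derived otherwise. Cases of different value
-- exclude each other by parity, by d or by the size of M.
NimValue-unique : ∀ {T M E n n′} → NimValue T M E n → NimValue T M E n′ → n ≡ n′
NimValue-unique (settled _)          (settled _)          = refl
NimValue-unique (settled M≤1)        (even-low 2≤M _ _)   = refl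
NimValue-unique (settled M≤1)        (even-high 2≤M _ _)  = contradiction M≤1 (<⇒≱ 2≤M)
NimValue-unique (settled M≤1)        (odd-low 2≤M _ _)    = contradiction M≤1 (<⇒≱ 2≤M)
NimValue-unique (settled M≤1)        (odd-mid 2≤M _ _ _)  = contradiction M≤1 (<⇒≱ 2≤M)
NimValue-unique (settled M≤1)        (odd-high 2≤M _ _)   = refl
NimValue-unique (even-low _ _ _)     (settled _)          = refl
NimValue-unique (even-low _ _ _)     (even-low _ _ _)     = refl
NimValue-unique (even-low _ _ low)   (even-high _ _ high) = contradiction low (<⇒≱ high)
NimValue-unique (even-low _ 2∣T _)   (odd-low _ 2∤T _)    = contradiction 2∣T 2∤T
NimValue-unique (even-low _ 2∣T _)   (odd-mid _ 2∤T _ _)  = contradiction 2∣T 2∤T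
NimValue-unique (even-low _ 2∣T _)   (odd-high _ 2∤T _)   = refl
NimValue-unique (even-high 2≤M _ _)  (settled M≤1)        = contradiction M≤1 (<⇒≱ 2≤M)
NimValue-unique (even-high _ _ high) (even-low _ _ low)   = contradiction low (<⇒≱ high)
NimValue-unique (even-high _ _ _)    (even-high _ _ _)    = refl
NimValue-unique (even-high _ _ _)    (odd-low _ _ _)      = refl
NimValue-unique (even-high _ 2∣T _)  (odd-mid _ 2∤T _ _)  = contradiction 2∣T 2∤T
NimValue-unique (even-high _ 2∣T _)  (odd-high _ 2∤T _)   = contradiction 2∣T 2∤T
NimValue-unique (odd-low 2≤M _ _)    (settled M≤1)        = contradiction M≤1 (<⇒≱ 2≤M)
NimValue-unique (odd-low _ 2∤T _)    (even-low _ 2∣T _)   = contradiction 2∣T 2∤T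
NimValue-unique (odd-low _ _ _)      (even-high _ _ _)    = refl
NimValue-unique (odd-low _ _ _)      (odd-low _ _ _)      = refl
NimValue-unique (odd-low _ _ low)    (odd-mid _ _ mid _)  = contradiction low (<⇒≱ mid)
NimValue-unique (odd-low _ _ low)    (odd-high _ _ high)  =
  contradiction low (<⇒≱ (≤-trans (s≤s (m≤n+m _ 2)) high))
NimValue-unique (odd-mid 2≤M _ _ _)  (settled M≤1)        = contradiction M≤1 (<⇒≱ 2≤M)
NimValue-unique (odd-mid _ 2∤T _ _)  (even-low _ 2∣T _)   = contradiction 2∣T 2∤T
NimValue-unique (odd-mid _ 2∤T _ _)  (even-high _ 2∣T _)  = contradiction 2∣T 2∤T
NimValue-unique (odd-mid _ _ mid _)  (odd-low _ _ low)    = contradiction low (<⇒≱ mid)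
NimValue-unique (odd-mid _ _ _ _)    (odd-mid _ _ _ _)    = refl
NimValue-unique (odd-mid _ _ _ mid)  (odd-high _ _ high)  = contradiction mid (<⇒≱ high)
NimValue-unique (odd-high _ _ _)     (settled _)          = refl
NimValue-unique (odd-high _ _ _)     (even-low _ _ _)     = refl
NimValue-unique (odd-high _ 2∤T _)   (even-high _ 2∣T _)  = contradiction 2∣T 2∤T
NimValue-unique (odd-high _ _ high)  (odd-low _ _ low)    =
  contradiction low (<⇒≱ (≤-trans (s≤s (m≤n+m _ 2)) high))
NimValue-unique (odd-high _ _ high)  (odd-mid _ _ _ mid)  = contradiction mid (<⇒≱ high)
NimValue-unique (odd-high _ _ _)     (odd-high _ _ _)     = refl

-- Covers the finished and the unfinished outcome of a move at once: with an even total and d ≤ 1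
-- the value is 0 in either.
low-even : ∀ {T M E} → 2 ∣ T → M ≤ 1 + E → NimValue T M E 0
low-even {M = M} 2∣T low with M ≤? 1
... | yes M≤1 = settled M≤1
... | no  M≰1 = even-low (≰⇒> M≰1) 2∣T low

high-even : ∀ {T M E} → 2 ∣ T → 2 + E ≤ M → NimValue T M E 1
high-even 2∣T high = even-high (≤-trans (s≤s (s≤s z≤n)) high) 2∣T high

high-odd : ∀ {T M E} → 2 ∤ T → 3 + E ≤ M → NimValue T M E 0
high-odd 2∤T high = odd-high (≤-trans (s≤s (s≤s z≤n)) high) 2∤T high

-- Heap positions and the removal of one token.

-- This is E. Subtracting the share of a largest heap from the full sum avoids a choice among tied
-- heaps, and `pred 0 = 0` makes empty heaps contribute nothing.
spare : Vector ℕ n → ℕ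
spare u = sum (pred ∘ u) ∸ pred (maximum u)

HeapNim : Vector ℕ n → ℕ → Set
HeapNim u = NimValue (sum u) (maximum u) (spare u)

-- Pointwise rather than through an update operation, so that vertex counts after a move qualify
-- directly.
record Removal (u : Vector ℕ n) (i : Fin n) (u′ : Vector ℕ n) : Set where
  field
    at   : u i ≡ suc (u′ i)
    away : ∀ j → j ≢ i → u j ≡ u′ j
open Removal

-- Some summand equals `pred (maximum u)`, so the subtraction in `spare` does not truncate.
spare-split : (u : Vector ℕ (suc k)) → sum (pred ∘ u) ≡ pred (maximum u) + spare u
spare-split u with maximum-attained u
... | c , u[c]≡M = sym (m+[n∸m]≡n
  (subst (λ x → pred x ≤ sum (pred ∘ u)) u[c]≡M (summand≤sum (pred ∘ u) c)))

spare-remove : (u : Vector ℕ (suc k)) {c : Fin (suc k)} → u c ≡ maximum u →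
               spare u ≡ sum (pred ∘ removeAt u c)
spare-remove u {c} u[c]≡M =
  trans (cong₂ _∸_ (sum-remove (pred ∘ u)) (cong pred (sym u[c]≡M))) (m+n∸m≡n (pred (u c)) _)

-- A nonzero `spare u` would come from a heap with two tokens. This supplies the premise on `E′` in
-- `NimValue-avoids`.
settled⇒spare≡0 : (u : Vector ℕ (suc k)) → maximum u ≤ 1 → spare u ≡ 0
settled⇒spare≡0 u M≤1 with spare u in eq
... | zero  = refl
... | suc e with maximum-attained u
...   | c , u[c]≡M with positive-summand (pred ∘ removeAt u c)
                      (λ Σ≡0 → contradiction (trans (sym eq) (trans (spare-remove u u[c]≡M) Σ≡0)) λ ())
...     | j , uⱼ≢0 =
  contradiction (n≤0⇒n≡0 (pred-mono-≤ (≤-trans (≤maximum u (punchIn c j)) M≤1))) uⱼ≢0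

module _ {u u′ : Vector ℕ (suc k)} {i : Fin (suc k)} (δ : Removal u i u′) where

  Removal-sum : sum u ≡ suc (sum u′)
  Removal-sum with sums-agreeing-off u u′ i (away δ)
  ... | r , Σu , Σu′ = trans Σu (trans (cong (_+ r) (at δ)) (cong suc (sym Σu′)))

  Removal-≤ : ∀ j → u′ j ≤ u j
  Removal-≤ j with j ≟ᶠ i
  ... | yes refl = ≤-trans (n≤1+n _) (≤-reflexive (sym (at δ)))
  ... | no  j≢i  = ≤-reflexive (sym (away δ j j≢i))

  Removal-maximum-≤ : maximum u′ ≤ maximum u
  Removal-maximum-≤ = maximum-least u′ λ j → ≤-trans (Removal-≤ j) (≤maximum u j)

  Removal-maximum-≥ : maximum u ≤ suc (maximum u′)
  Removal-maximum-≥ = maximum-least u u≤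
    where
    u≤ : ∀ j → u j ≤ suc (maximum u′)
    u≤ j with j ≟ᶠ i
    ... | yes refl = ≤-trans (≤-reflexive (at δ)) (s≤s (≤maximum u′ j))
    ... | no  j≢i  = m≤n⇒m≤1+n (≤-trans (≤-reflexive (away δ j j≢i)) (≤maximum u′ j))

  Removal-maximum-≡ : ∀ {c} → u c ≡ maximum u → i ≢ c → maximum u ≡ maximum u′
  Removal-maximum-≡ {c} u[c]≡M i≢c = ≤-antisym
    (≤-trans (≤-reflexive (trans (sym u[c]≡M) (away δ c (i≢c ∘ sym)))) (≤maximum u′ c))
    Removal-maximum-≤

  Removal-sum-pred-singleton : u′ i ≡ 0 → sum (pred ∘ u) ≡ sum (pred ∘ u′)
  Removal-sum-pred-singleton u′ᵢ≡0
    with sums-agreeing-off (pred ∘ u) (pred ∘ u′) i (λ j j≢i → cong pred (away δ j j≢i))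
  ... | r , Σu , Σu′ = trans Σu (trans (cong (_+ r)
          (trans (cong pred (at δ)) (trans u′ᵢ≡0 (sym (cong pred u′ᵢ≡0))))) (sym Σu′))

  Removal-sum-pred : u′ i ≢ 0 → sum (pred ∘ u) ≡ suc (sum (pred ∘ u′))
  Removal-sum-pred u′ᵢ≢0
    with sums-agreeing-off (pred ∘ u) (pred ∘ u′) i (λ j j≢i → cong pred (away δ j j≢i))
  ... | r , Σu , Σu′ = trans Σu (trans (cong (_+ r)
          (trans (cong pred (at δ)) (sym (suc-pred _ {{≢-nonZero u′ᵢ≢0}})))) (cong suc (sym Σu′)))

  module _ (2≤M : 2 ≤ maximum u) where

    Removal-shift-singleton : u′ i ≡ 0 → maximum u ≡ maximum u′ × spare u ≡ spare u′
    Removal-shift-singleton u′ᵢ≡0 with maximum-attained u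
    ... | c , u[c]≡M = M≡M′ , cong₂ (λ s x → s ∸ pred x) (Removal-sum-pred-singleton u′ᵢ≡0) M≡M′
      where
      -- The vanishing heap holds one token, a largest heap at least two.
      i≢c : i ≢ c
      i≢c refl = <⇒≱ 2≤M (≤-reflexive (trans (sym u[c]≡M) (trans (at δ) (cong suc u′ᵢ≡0))))
      M≡M′ = Removal-maximum-≡ u[c]≡M i≢c

    -- The maximum keeps its share, so the lost token comes out of `spare`. This includes a token
    -- taken from one of several tied largest heaps.
    Removal-spare-other : u′ i ≢ 0 → maximum u ≡ maximum u′ → spare u ≡ suc (spare u′)
    Removal-spare-other u′ᵢ≢0 M≡M′ = +-cancelˡ-≡ (pred (maximum u)) _ _ (begin
      pred (maximum u) + spare u           ≡⟨ spare-split u ⟨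
      sum (pred ∘ u)                       ≡⟨ Removal-sum-pred u′ᵢ≢0 ⟩
      suc (sum (pred ∘ u′))                ≡⟨ cong suc (spare-split u′) ⟩
      suc (pred (maximum u′) + spare u′)   ≡⟨ +-suc _ _ ⟨
      pred (maximum u′) + suc (spare u′)   ≡⟨ cong (λ x → pred x + _) M≡M′ ⟨
      pred (maximum u) + suc (spare u′)    ∎)
      where open ≡-Reasoning

    Removal-spare-largest : u′ i ≢ 0 → maximum u ≡ suc (maximum u′) → spare u ≡ spare u′
    Removal-spare-largest u′ᵢ≢0 M≡1+M′ with maximum u′ in eq
    -- At M′ = 0 `pred` would not register the drop of the maximum; `2 ≤ M` rules this out.
    ... | zero  = contradiction (subst (2 ≤_) M≡1+M′ 2≤M) λ { (s≤s ()) }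
    ... | suc x = cong₂ _∸_ (Removal-sum-pred u′ᵢ≢0) (cong pred M≡1+M′)

    Removal-shift-other : u′ i ≢ 0 → ∀ {c} → u c ≡ maximum u → i ≢ c →
                          maximum u ≡ maximum u′ × spare u ≡ suc (spare u′)
    Removal-shift-other u′ᵢ≢0 u[c]≡M i≢c = M≡M′ , Removal-spare-other u′ᵢ≢0 M≡M′
      where M≡M′ = Removal-maximum-≡ u[c]≡M i≢c

    Removal-shift : Shift (maximum u) (spare u) (maximum u′) (spare u′)
    Removal-shift with u′ i ≟ 0
    ... | yes u′ᵢ≡0 with Removal-shift-singleton u′ᵢ≡0
    ...   | M≡ , E≡ = idle M≡ E≡
    -- The two maxima decide, not whether heap `i` is a largest one: under a tie the maximum
    -- survives and the case is `other`.
    Removal-shift | no u′ᵢ≢0 with maximum u ≟ maximum u′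
    ... | yes M≡M′ = other M≡M′ (Removal-spare-other u′ᵢ≢0 M≡M′)
    ... | no  M≢M′ = largest M≡1+M′ (Removal-spare-largest u′ᵢ≢0 M≡1+M′)
      where M≡1+M′ = ≤-antisym Removal-maximum-≥ (≤∧≢⇒< Removal-maximum-≤ (M≢M′ ∘ sym))

    -- Every other heap has at most M - 1 tokens, which is what heap `i` keeps, so heap `i` is still
    -- a largest one afterwards.
    Removal-shift-unique : u i ≡ maximum u → (∀ j → j ≢ i → u j ≢ u i) →
                           maximum u ≡ suc (maximum u′) × spare u ≡ spare u′
    Removal-shift-unique uᵢ≡M unique = M≡1+M′ , Removal-spare-largest u′ᵢ≢0 M≡1+M′
      where
      u′ᵢ≢0 : u′ i ≢ 0
      u′ᵢ≢0 u′ᵢ≡0 = <⇒≱ 2≤M (≤-reflexive (trans (sym uᵢ≡M) (trans (at δ) (cong suc u′ᵢ≡0))))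
      u′≤ : ∀ j → u′ j ≤ u′ i
      u′≤ j with j ≟ᶠ i
      ... | yes refl = ≤-refl
      ... | no  j≢i  = s≤s⁻¹ (subst (u′ j <_) (at δ) (subst (_< u i) (away δ j j≢i)
                         (≤∧≢⇒< (≤-trans (≤maximum u j) (≤-reflexive (sym uᵢ≡M))) (unique j j≢i))))
      M≡1+M′ : maximum u ≡ suc (maximum u′)
      M≡1+M′ = trans (sym uᵢ≡M) (trans (at δ)
        (cong suc (≤-antisym (≤maximum u′ i) (maximum-least u′ u′≤))))

    HeapNim-avoids : ∀ {n j} → HeapNim u n → HeapNim u′ j → j ≢ n
    HeapNim-avoids {n} ν ν′ = NimValue-avoids 2≤M Removal-shift (settled⇒spare≡0 u′)
      (subst (λ T → NimValue T (maximum u) (spare u) n) Removal-sum ν) ν′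

-- Moves that realise the smaller values.

Tie : Vector ℕ n → Fin n → Set
Tie u c = ∃[ j ] (j ≢ c × u j ≡ u c)

module _ (u : Vector ℕ (suc k)) where

  tie? : ∀ c → Dec (Tie u c)
  tie? c = any? λ j → ¬? (j ≟ᶠ c) ×-dec (u j ≟ u c)

  no-tie⇒unique : ∀ {c} → ¬ Tie u c → ∀ j → j ≢ c → u j ≢ u c
  no-tie⇒unique ¬tie j j≢c uⱼ≡u[c] = ¬tie (j , j≢c , uⱼ≡u[c])

  module _ {c : Fin (suc k)} (u[c]≡M : u c ≡ maximum u) where

    -- The tied heap is among those counted in `spare`, with M - 1 tokens beyond its first. Hence a
    -- tie forces d ≤ 1.
    tie⇒pred-maximum≤spare : Tie u c → pred (maximum u) ≤ spare u
    tie⇒pred-maximum≤spare (j , j≢c , uⱼ≡u[c]) = begin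
      pred (maximum u)                            ≡⟨ cong pred (trans uⱼ≡u[c] u[c]≡M) ⟨
      pred (u j)                                  ≡⟨ cong (pred ∘ u) (punchIn-punchOut c≢j) ⟨
      pred (removeAt u c (punchOut c≢j))          ≤⟨ summand≤sum (pred ∘ removeAt u c) _ ⟩
      sum (pred ∘ removeAt u c)                   ≡⟨ spare-remove u u[c]≡M ⟨
      spare u                                     ∎
      where
      open ≤-Reasoning
      c≢j = j≢c ∘ sym

    -- The alternative is a lone heap, where d = M = T; the parity of T will exclude it when d is 3
    -- or 2.
    other-nonempty : (∃[ i ] (i ≢ c × u i ≢ 0)) ⊎ (sum u ≡ maximum u × spare u ≡ 0)
    other-nonempty with sum (removeAt u c) ≟ 0
    ... | no  Σ≢0 with positive-summand (removeAt u c) Σ≢0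
    ...   | j , uⱼ≢0 = inj₁ (punchIn c j , punchInᵢ≢i c j , uⱼ≢0)
    other-nonempty | yes Σ≡0 = inj₂
      ( trans (sum-remove u) (trans (cong₂ _+_ u[c]≡M Σ≡0) (+-identityʳ _))
      , trans (spare-remove u u[c]≡M)
          (n≤0⇒n≡0 (≤-trans (sum-pred≤sum (removeAt u c)) (≤-reflexive Σ≡0))))

    other-nontrivial : spare u ≢ 0 → ∃[ i ] (i ≢ c × pred (u i) ≢ 0)
    other-nontrivial E≢0
      with positive-summand (pred ∘ removeAt u c) (E≢0 ∘ trans (spare-remove u u[c]≡M))
    ... | j , uⱼ≢0 = punchIn c j , punchInᵢ≢i c j , uⱼ≢0

-- Two tied largest heaps already account for all of spare u, so the others are
-- singletons, and parity makes one of them exist.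
tie⇒singleton : (u : Vector ℕ (suc k)) {c : Fin (suc k)} → u c ≡ maximum u → Tie u c →
                pred (maximum u) ≡ spare u → 2 ∤ sum u → ∃[ i ] u i ≡ 1
tie⇒singleton {k = zero} u {zero} _ (zero , j≢c , _) _ _ = contradiction refl j≢c
tie⇒singleton {k = suc k} u {c} u[c]≡M (j , j≢c , uⱼ≡u[c]) predM≡E 2∤Σ = singleton
  where
  open ≡-Reasoning
  v  = removeAt u c
  j′ = punchOut (j≢c ∘ sym)
  w  = removeAt v j′
  vⱼ≡M : v j′ ≡ maximum u
  vⱼ≡M = trans (cong u (punchIn-punchOut (j≢c ∘ sym))) (trans uⱼ≡u[c] u[c]≡M)
  Σpred-w≡0 : sum (pred ∘ w) ≡ 0
  Σpred-w≡0 = +-cancelˡ-≡ (pred (maximum u)) _ _ (begin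
    pred (maximum u) + sum (pred ∘ w) ≡⟨ cong (λ x → pred x + sum (pred ∘ w)) vⱼ≡M ⟨
    pred (v j′) + sum (pred ∘ w)      ≡⟨ sum-remove (pred ∘ v) ⟨
    sum (pred ∘ v)                    ≡⟨ spare-remove u u[c]≡M ⟨
    spare u                           ≡⟨ predM≡E ⟨
    pred (maximum u)                  ≡⟨ +-identityʳ _ ⟨
    pred (maximum u) + 0              ∎)
  Σu : sum u ≡ (maximum u + maximum u) + sum w
  Σu = begin
    sum u                               ≡⟨ sum-remove u ⟩
    u c + sum v                         ≡⟨ cong₂ _+_ u[c]≡M (sum-remove v) ⟩
    maximum u + (v j′ + sum w)          ≡⟨ cong (λ x → maximum u + (x + sum w)) vⱼ≡M ⟩
    maximum u + (maximum u + sum w)     ≡⟨ +-assoc (maximum u) _ _ ⟨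
    (maximum u + maximum u) + sum w     ∎
  Σw≢0 : sum w ≢ 0
  Σw≢0 Σw≡0 = 2∤Σ (subst (2 ∣_)
    (sym (trans Σu (trans (cong (_ ℕ.+_) Σw≡0) (+-identityʳ _)))) (2∣n+n (maximum u)))
  singleton : ∃[ i ] u i ≡ 1
  singleton with positive-summand w Σw≢0
  ... | l , wₗ≢0 = _ , ≤-antisym
    (≤-trans (m≤n+m∸n (w l) 1)
      (s≤s (≤-trans (summand≤sum (pred ∘ w) l) (≤-reflexive Σpred-w≡0))))
    (n≢0⇒n>0 wₗ≢0)

-- Quantifying over every outcome `u′` leaves open which vertex of part `i` is played.
Reaches : Vector ℕ n → ℕ → Set
Reaches u j = ∃[ i ] (u i ≢ 0 × (∀ {u′} → Removal u i u′ → HeapNim u′ j))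

module _ (u : Vector ℕ (suc k)) (2≤M : 2 ≤ maximum u) where
  private
    c = proj₁ (maximum-attained u)
    u[c]≡M : u c ≡ maximum u
    u[c]≡M = proj₂ (maximum-attained u)

    T = sum u
    M = maximum u
    E = spare u

    u[c]≢0 : u c ≢ 0
    u[c]≢0 u[c]≡0 = <⇒≱ 2≤M (≤-trans (≤-reflexive (trans (sym u[c]≡M) u[c]≡0)) z≤n)

  module _ {u′ : Vector ℕ (suc k)} {i : Fin (suc k)} (δ : Removal u i u′) where

    Removal-even : 2 ∤ T → 2 ∣ sum u′
    Removal-even 2∤T with 2 ∣? sum u′
    ... | yes 2∣T′ = 2∣T′
    ... | no  2∤T′ =
      contradiction (subst (2 ∣_) (sym (Removal-sum δ)) (2∤n⇒2∣1+n _ 2∤T′)) 2∤T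

    Removal-odd : 2 ∣ T → 2 ∤ sum u′
    Removal-odd 2∣T 2∣T′ = 2∣n⇒2∤1+n 2∣T′ (subst (2 ∣_) (Removal-sum δ) 2∣T)

    -- Off `c` a singleton leaves d alone and any larger heap raises it, so lower bounds on d
    -- survive.
    Removal-away-from-largest : i ≢ c → ∀ t → t + E ≤ M → t + spare u′ ≤ maximum u′
    Removal-away-from-largest i≢c t le with u′ i ≟ 0
    ... | yes u′ᵢ≡0 with Removal-shift-singleton δ 2≤M u′ᵢ≡0
    ...   | M≡ , E≡ = subst₂ (λ x y → t + x ≤ y) E≡ M≡ le
    Removal-away-from-largest i≢c t le | no u′ᵢ≢0
      with Removal-shift-other δ 2≤M u′ᵢ≢0 u[c]≡M i≢c
    ... | M≡ , E≡ = ≤-trans (+-monoʳ-≤ t (n≤1+n _)) (subst₂ (λ x y → t + x ≤ y) E≡ M≡ le)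

    -- E drops by one and `c` preserves M, so d rises.
    Removal-nontrivial : pred (u i) ≢ 0 → i ≢ c → ∀ t → t + E ≤ M → suc t + spare u′ ≤ maximum u′
    Removal-nontrivial uᵢ≢1 i≢c t le
      with Removal-shift-other δ 2≤M (uᵢ≢1 ∘ trans (cong pred (at δ))) u[c]≡M i≢c
    ... | M≡ , E≡ = subst (_≤ maximum u′) (+-suc t _) (subst₂ (λ x y → t + x ≤ y) E≡ M≡ le)

  -- The move aims at an odd total with d ≥ 3, or else at a finished game.
  even-high-reaches-0 : 2 ∣ T → 2 + E ≤ M → Reaches u 0
  even-high-reaches-0 2∣T high with 4 + E ≤? M
  -- Any move keeps d ≥ 3; `c` is a heap known to be nonempty.
  ... | yes d≥4 = c , u[c]≢0 , λ δ →
    high-odd (Removal-odd δ 2∣T) (shift-lower (Removal-shift δ 2≤M) 3 d≥4)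
  ... | no  d≱4 with 3 + E ≤? M
  ...   | yes d≥3 = d≡3 (other-nonempty u u[c]≡M)
    where
    d≡3 : (∃[ i ] (i ≢ c × u i ≢ 0)) ⊎ (T ≡ M × E ≡ 0) → Reaches u 0
    d≡3 (inj₁ (i , i≢c , uᵢ≢0)) = i , uᵢ≢0 , λ δ →
      high-odd (Removal-odd δ 2∣T) (Removal-away-from-largest δ i≢c 3 d≥3)
    -- A lone heap would hold three tokens, an odd total.
    d≡3 (inj₂ (T≡M , E≡0)) = contradiction (subst (2 ∣_) T≡3 2∣T) (from-no (2 ∣? 3))
      where
      T≡3 : T ≡ 3
      T≡3 = trans T≡M (trans (≤-antisym (s≤s⁻¹ (≰⇒> d≱4)) d≥3) (cong (3 ℕ.+_) E≡0))
  ...   | no  d≱3 with E ≟ 0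
  ...     | no  E≢0 with other-nontrivial u u[c]≡M E≢0
  -- Here d = 2, and this move raises it to 3.
  ...       | i , i≢c , uᵢ≢1 = i , (λ uᵢ≡0 → uᵢ≢1 (cong pred uᵢ≡0)) , λ δ →
    high-odd (Removal-odd δ 2∣T) (Removal-nontrivial δ uᵢ≢1 i≢c 2 high)
  -- Now M = 2 and E = 0, so `c` is the only heap with two tokens and a move there finishes the
  -- game.
  even-high-reaches-0 2∣T high | no d≱4 | no d≱3 | yes E≡0 = c , u[c]≢0 , λ δ →
    settled (s≤s⁻¹ (subst (_≤ 2) (proj₁ (Removal-shift-unique δ 2≤M u[c]≡M (no-tie⇒unique u ¬tie))) M≤2))
    where
    M≤2 : M ≤ 2
    M≤2 = subst (λ e → M ≤ 2 + e) E≡0 (s≤s⁻¹ (≰⇒> d≱3))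
    ¬tie : ¬ Tie u c
    ¬tie t = <⇒≱ (pred-mono-≤ 2≤M)
      (≤-trans (tie⇒pred-maximum≤spare u u[c]≡M t) (≤-reflexive E≡0))

  -- One move brings d to at most 1, so any nonempty heap will do.
  odd-low-reaches-0 : 2 ∤ T → M ≤ E → Reaches u 0
  odd-low-reaches-0 2∤T low = c , u[c]≢0 , λ δ →
    low-even (Removal-even δ 2∤T) (shift-upper (Removal-shift δ 2≤M) 0 low)

  -- The target is an even total with d ≤ 1. A move in a unique largest heap lowers d; a tie forces
  -- d = 1, which taking a singleton preserves.
  odd-mid-reaches-0 : 2 ∤ T → 1 + E ≤ M → M ≤ 2 + E → Reaches u 0
  odd-mid-reaches-0 2∤T 1+E≤M M≤2+E with tie? u c
  ... | no ¬tie = c , u[c]≢0 , λ {u′} δ →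
    let M≡ , E≡ = Removal-shift-unique δ 2≤M u[c]≡M (no-tie⇒unique u ¬tie)
    in low-even (Removal-even δ 2∤T)
         (s≤s⁻¹ (subst₂ (λ x e → x ≤ 2 + e) M≡ E≡ M≤2+E))
  ... | yes tie with tie⇒singleton u u[c]≡M tie
                       (≤-antisym (tie⇒pred-maximum≤spare u u[c]≡M tie) (pred-mono-≤ 1+E≤M)) 2∤T
  ...   | i , uᵢ≡1 = i , (λ uᵢ≡0 → contradiction (trans (sym uᵢ≡1) uᵢ≡0) λ ()) , λ δ →
    let M≡ , E≡ = Removal-shift-singleton δ 2≤M (suc-injective (trans (sym (at δ)) uᵢ≡1))
    in low-even (Removal-even δ 2∤T) (subst₂ (λ x e → x ≤ 1 + e) M≡ E≡ M≤1+E)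
    where
    M≤1+E : M ≤ 1 + E
    M≤1+E = ≤-trans (m≤n+m∸n M 1) (s≤s (tie⇒pred-maximum≤spare u u[c]≡M tie))

  -- The target is an even total with d ≥ 2. At d = 2 any nonempty heap besides `c` serves; at d = 1
  -- one with two or more tokens raises d.
  odd-mid-reaches-1 : 2 ∤ T → 1 + E ≤ M → M ≤ 2 + E → Reaches u 1
  odd-mid-reaches-1 2∤T 1+E≤M M≤2+E with 2 + E ≤? M
  ... | yes 2+E≤M = d≡2 (other-nonempty u u[c]≡M)
    where
    d≡2 : (∃[ i ] (i ≢ c × u i ≢ 0)) ⊎ (T ≡ M × E ≡ 0) → Reaches u 1
    d≡2 (inj₁ (i , i≢c , uᵢ≢0)) = i , uᵢ≢0 , λ δ →
      high-even (Removal-even δ 2∤T) (Removal-away-from-largest δ i≢c 2 2+E≤M)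
    -- A lone heap would hold two tokens, an even total.
    d≡2 (inj₂ (T≡M , E≡0)) = contradiction (subst (2 ∣_) (sym T≡2) ∣-refl) 2∤T
      where
      T≡2 : T ≡ 2
      T≡2 = trans T≡M (trans (≤-antisym M≤2+E 2+E≤M) (cong (2 ℕ.+_) E≡0))
  ... | no  2+E≰M with other-nontrivial u u[c]≡M E≢0
    where
    -- With E = 0, d would be M, which is at least 2.
    E≢0 : E ≢ 0
    E≢0 E≡0 = 2+E≰M (subst (λ e → 2 + e ≤ M) (sym E≡0) 2≤M)
  ...   | i , i≢c , uᵢ≢1 = i , (λ uᵢ≡0 → uᵢ≢1 (cong pred uᵢ≡0)) , λ δ →
    high-even (Removal-even δ 2∤T) (Removal-nontrivial δ uᵢ≢1 i≢c 1 1+E≤M)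

HeapNim-reaches : (u : Vector ℕ (suc k)) → ∀ {n j} → HeapNim u n → j < n → Reaches u j
HeapNim-reaches u {j = zero} (even-high 2≤M 2∣T high) _ = even-high-reaches-0 u 2≤M 2∣T high
HeapNim-reaches u {j = zero} (odd-low 2≤M 2∤T low) _ = odd-low-reaches-0 u 2≤M 2∤T low
HeapNim-reaches u {j = zero} (odd-mid 2≤M 2∤T 1+E≤M M≤2+E) _ =
  odd-mid-reaches-0 u 2≤M 2∤T 1+E≤M M≤2+E
HeapNim-reaches u {j = suc zero} (odd-mid 2≤M 2∤T 1+E≤M M≤2+E) _ =
  odd-mid-reaches-1 u 2≤M 2∤T 1+E≤M M≤2+E
HeapNim-reaches u {j = suc zero} (even-high _ _ _) (s≤s ())
HeapNim-reaches u {j = suc zero} (odd-low _ _ _) (s≤s ())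
HeapNim-reaches u {j = suc (suc j)} (odd-mid _ _ _ _) (s≤s (s≤s ()))
HeapNim-reaches u {j = suc (suc j)} (even-high _ _ _) (s≤s ())
HeapNim-reaches u {j = suc (suc j)} (odd-low _ _ _) (s≤s ())

-- Convexity in complete multipartite graphs.

distinct-elements : 2 ≤ n → Σ[ a ∈ Fin n ] ∃[ b ] a ≢ b
distinct-elements (s≤s (s≤s _)) = zero , suc zero , λ ()

module _ {m : Vector ℕ k} where
  private
    G = completeMultipartite m
    V = Graph.V G

  _≟ᵛ_ : (x y : V) → Dec (x ≡ y)
  _≟ᵛ_ = ≡-dec _≟ᶠ_ _≟ᶠ_

  same-part-injective : ∀ {i} {j j′ : Fin (m i)} → _≡_ {A = V} (i , j) (i , j′) → j ≡ j′
  same-part-injective refl = refl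

  2≤edgeCount : ∀ {x y : V} → x ≢ y → proj₁ x ≡ proj₁ y → (w : Walk G x y) → 2 ≤ edgeCount G w
  2≤edgeCount x≢y _    ε           = contradiction refl x≢y
  2≤edgeCount _   same (e ◅ ε)     = contradiction same e
  2≤edgeCount _   _    (_ ◅ _ ◅ _) = s≤s (s≤s z≤n)

  -- Two vertices of one part are at distance 2, so the detour through any `z` of another part is a
  -- shortest path.
  Convex-spread : ∀ {K : Pred V 0ℓ} → Convex G K → ∀ {i} {j j′ : Fin (m i)} → j ≢ j′ →
                  (i , j) ∈ K → (i , j′) ∈ K → ∀ z → proj₁ z ≢ i → z ∈ K
  Convex-spread {K} convex {i} {j} {j′} j≢j′ x∈K y∈K z z≢ =
    convex x∈K y∈K through-z (distinct , λ u _ → 2≤edgeCount x≢y refl u) (there (here refl))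
    where
    x≢y : _≢_ {A = V} (i , j) (i , j′)
    x≢y = j≢j′ ∘ same-part-injective
    through-z : Walk G (i , j) (i , j′)
    through-z = _◅_ {j = z} (z≢ ∘ sym) (z≢ ◅ ε)
    distinct : IsPath G through-z
    distinct = (z≢ ∘ sym ∘ cong proj₁ ∷ᴬ x≢y ∷ᴬ []ᴬ) ∷ᴾ (z≢ ∘ cong proj₁ ∷ᴬ []ᴬ) ∷ᴾ []ᴬ ∷ᴾ []ᴾ

  -- Spread twice: from part `i` to all others, then from two vertices of part `i₂` back to part
  -- `i`.
  Hull-universal : ∀ {P : Pred V 0ℓ} {i} {j j′ : Fin (m i)} → j ≢ j′ → (i , j) ∈ P → (i , j′) ∈ P →
                   ∀ {i₂} → i₂ ≢ i → 2 ≤ m i₂ → Universal (Hull G P)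
  Hull-universal {i = i} j≢j′ x∈P y∈P {i₂} i₂≢i 2≤mi₂ z K convex P⊆K
    with proj₁ z ≟ᶠ i | distinct-elements 2≤mi₂
  ... | no  z≢   | _           = Convex-spread convex j≢j′ (P⊆K x∈P) (P⊆K y∈P) z z≢
  ... | yes refl | a , b , a≢b =
    Convex-spread {K} convex a≢b (outside (i₂ , a) i₂≢i) (outside (i₂ , b) i₂≢i) z (i₂≢i ∘ sym)
    where
    outside : ∀ y → proj₁ y ≢ i → y ∈ K
    outside = Convex-spread convex j≢j′ (P⊆K x∈P) (P⊆K y∈P)

  Clique : Pred V 0ℓ → Set
  Clique P = ∀ {x y} → x ∈ P → y ∈ P → proj₁ x ≡ proj₁ y → x ≡ y

  -- Distinct members lie in different parts and so are adjacent; a shortest path between them is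
  -- one edge, with no inner vertex.
  Clique⇒Convex : ∀ {P} → Clique P → Convex G P
  Clique⇒Convex {P} clique {x} {y} x∈P y∈P w (_ , shortest) v∈w with proj₁ x ≟ᶠ proj₁ y
  ... | yes same with clique x∈P y∈P same
  ...   | refl = on-ε w (shortest ε ([]ᴬ ∷ᴾ []ᴾ)) v∈w
    where
    on-ε : ∀ (w : Walk G x x) → edgeCount G w ≤ 0 → ∀ {v} → v ∈ˡ vertices G w → v ∈ P
    on-ε ε _ (here refl) = x∈P
  Clique⇒Convex {P} clique {x} {y} x∈P y∈P w (_ , shortest) v∈w | no x≁y =
    on-edge w (shortest (x≁y ◅ ε) ((x≁y ∘ cong proj₁ ∷ᴬ []ᴬ) ∷ᴾ []ᴬ ∷ᴾ []ᴾ)) v∈w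
    where
    on-edge : ∀ (w : Walk G x y) → edgeCount G w ≤ 1 → ∀ {v} → v ∈ˡ vertices G w → v ∈ P
    on-edge ε       _ (here refl)         = x∈P
    on-edge (_ ◅ ε) _ (here refl)         = x∈P
    on-edge (_ ◅ ε) _ (there (here refl)) = y∈P
    on-edge (_ ◅ _ ◅ _) (s≤s ()) _

  -- A clique is its own hull, and no clique contains a part with two vertices.
  Clique⇒¬Hull-universal : ∀ {P i} → Clique P → 2 ≤ m i → ¬ Universal (Hull G P)
  Clique⇒¬Hull-universal {P} {i} clique 2≤mi universal with distinct-elements 2≤mi
  ... | a , b , a≢b =
    a≢b (same-part-injective (clique (everything (i , a)) (everything (i , b)) refl))
    where
    everything : ∀ v → v ∈ P
    everything v = universal v P (Clique⇒Convex clique) (λ v∈P → v∈P)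

-- Heap sizes as counts of unplayed vertices.

-- The weight sits on the complement, since the vertices to be counted are the unplayed ones.
indicator : ∀ {ℓ} {A : Set ℓ} → Dec A → ℕ
indicator a? = if does a? then 0 else 1

indicator-≤1 : ∀ {ℓ} {A : Set ℓ} (a? : Dec A) → indicator a? ≤ 1
indicator-≤1 (yes _) = z≤n
indicator-≤1 (no  _) = ≤-refl

indicator≢0⇒¬ : ∀ {ℓ} {A : Set ℓ} (a? : Dec A) → indicator a? ≢ 0 → ¬ A
indicator≢0⇒¬ (yes _)  ≢0 = contradiction refl ≢0
indicator≢0⇒¬ (no ¬a) _  = ¬a

¬⇒indicator≡1 : ∀ {ℓ} {A : Set ℓ} (a? : Dec A) → ¬ A → indicator a? ≡ 1
¬⇒indicator≡1 (yes a) ¬a = contradiction a ¬a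
¬⇒indicator≡1 (no _)  _  = refl

-- With entries of at most 1, a single positive entry cannot account for the sum.
two-positive-summands : (x : Vector ℕ n) → (∀ j → x j ≤ 1) → 2 ≤ sum x →
                        ∃[ j ] ∃[ j′ ] (j ≢ j′ × x j ≢ 0 × x j′ ≢ 0)
two-positive-summands {n = zero}  x _ ()
two-positive-summands {n = suc n} x x≤1 2≤Σ
  with positive-summand x (λ Σ≡0 → <⇒≱ 2≤Σ (≤-trans (≤-reflexive Σ≡0) z≤n))
... | j , xⱼ≢0 with positive-summand (removeAt x j) rest≢0
  where
  rest≢0 : sum (removeAt x j) ≢ 0
  rest≢0 rest≡0 = <⇒≱ 2≤Σ (≤-trans (≤-reflexive
    (trans (sum-remove x) (trans (cong (x j ℕ.+_) rest≡0) (+-identityʳ _)))) (x≤1 j))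
... | j′ , xⱼ′≢0 = j , punchIn j j′ , punchInᵢ≢i j j′ ∘ sym , xⱼ≢0 , xⱼ′≢0

two-summands≤sum : (x : Vector ℕ n) {j j′ : Fin n} → j ≢ j′ → x j + x j′ ≤ sum x
two-summands≤sum {n = suc n} x {j} {j′} j≢j′ = begin
  x j + x j′                                ≡⟨ cong (λ l → x j + x l) (punchIn-punchOut j≢j′) ⟨
  x j + removeAt x j (punchOut j≢j′)        ≤⟨ +-monoʳ-≤ (x j) (summand≤sum (removeAt x j) _) ⟩
  x j + sum (removeAt x j)                  ≡⟨ sum-remove x ⟨
  sum x                                     ∎
  where open ≤-Reasoning

module _ {m : Vector ℕ k} where
  private
    G = completeMultipartite m
    V = Graph.V G

  -- Translates played vertices into heap sizes. Positions are bare predicates, so a decision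
  -- procedure travels with them.
  remaining : {P : Pred V 0ℓ} → Decidable P → Vector ℕ k
  remaining P? i = sum λ j → indicator (P? (i , j))

  add? : {P : Pred V 0ℓ} → Decidable P → ∀ v → Decidable (P ∪ ｛ v ｝)
  add? P? v = P? ∪? (v ≟ᵛ_)

  indicator-add-other : {P : Pred V 0ℓ} (P? : Decidable P) {v x : V} → v ≢ x →
                        indicator (P? x) ≡ indicator (add? P? v x)
  indicator-add-other P? {v} {x} v≢x = cong (λ b → if b then 0 else 1) (begin
    does (P? x)                      ≡⟨ ∨-identityʳ _ ⟨
    does (P? x) ∨ false              ≡⟨ cong (does (P? x) ∨_) (dec-false (v ≟ᵛ x) v≢x) ⟨
    does (P? x) ∨ does (v ≟ᵛ x)      ∎)
    where open ≡-Reasoning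

  indicator-add-self : {P : Pred V 0ℓ} (P? : Decidable P) (v : V) → indicator (add? P? v v) ≡ 0
  indicator-add-self P? v = cong (λ b → if b then 0 else 1)
    (trans (cong (does (P? v) ∨_) (dec-true (v ≟ᵛ v) refl)) (∨-zeroʳ _))

  remaining-Removal : {P : Pred V 0ℓ} (P? : Decidable P) {v : V} → v ∉ P →
                      Removal (remaining P?) (proj₁ v) (remaining (add? P? v))
  remaining-Removal P? {v@(i , j)} v∉P = record
    { at   = at-v
    ; away = λ i′ i′≢i → sum-cong-≗ {m i′} λ j′ → indicator-add-other P? {v} {i′ , j′} (i′≢i ∘ sym ∘ cong proj₁)
    }
    where
    at-v : remaining P? i ≡ suc (remaining (add? P? v) i)
    at-v with sums-agreeing-off (λ j′ → indicator (P? (i , j′))) (λ j′ → indicator (add? P? v (i , j′))) j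
                (λ j′ j′≢j → indicator-add-other P? {v} {i , j′} (j′≢j ∘ sym ∘ same-part-injective))
    ... | r , Σ , Σ′ = trans Σ (trans (cong (_+ r) (¬⇒indicator≡1 (P? v) v∉P))
          (cong suc (sym (trans Σ′ (cong (_+ r) (indicator-add-self P? v))))))

  unplayed-vertex : {P : Pred V 0ℓ} (P? : Decidable P) {i : Fin k} → remaining P? i ≢ 0 →
                    ∃[ j ] (i , j) ∉ P
  unplayed-vertex P? {i} ≢0 with positive-summand (λ j → indicator (P? (i , j))) ≢0
  ... | j , χ≢0 = j , indicator≢0⇒¬ (P? (i , j)) χ≢0

  settled⇒Clique : {P : Pred V 0ℓ} (P? : Decidable P) → maximum (remaining P?) ≤ 1 → Clique (∁ P)
  settled⇒Clique P? M≤1 {i , j} {.i , j′} x∉P y∉P refl with j ≟ᶠ j′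
  ... | yes refl = refl
  ... | no  j≢j′ = contradiction (≤-trans (≤maximum (remaining P?) i) M≤1) (<⇒≱ (begin
    2                                                  ≡⟨ cong₂ _+_ (¬⇒indicator≡1 (P? (i , j)) x∉P) (¬⇒indicator≡1 (P? (i , j′)) y∉P) ⟨
    indicator (P? (i , j)) + indicator (P? (i , j′))   ≤⟨ two-summands≤sum (λ l → indicator (P? (i , l))) j≢j′ ⟩
    remaining P? i                                     ∎))
    where open ≤-Reasoning

-- The vertex game follows the heap game.

module _ {m : Vector ℕ (suc k)} (another : ∀ i → ∃[ i′ ] (i′ ≢ i × 2 ≤ m i′)) where
  private
    G = completeMultipartite m
    V = Graph.V G

  -- A largest heap provides two unplayed vertices of one part, and `another` the nontrivial part
  -- through which the hull returns to it.
  unsettled⇒Hull-universal : {P : Pred V 0ℓ} (P? : Decidable P) → 2 ≤ maximum (remaining P?) →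
                             Universal (Hull G (∁ P))
  unsettled⇒Hull-universal {P} P? 2≤M with maximum-attained (remaining P?)
  ... | i , rᵢ≡M
    with two-positive-summands (λ j → indicator (P? (i , j))) (λ j → indicator-≤1 (P? (i , j)))
           (subst (2 ≤_) (sym rᵢ≡M) 2≤M)
       | another i
  ...   | j , j′ , j≢j′ , χⱼ≢0 , χⱼ′≢0 | i′ , i′≢i , 2≤mi′ =
    Hull-universal {P = ∁ P} j≢j′ (indicator≢0⇒¬ (P? (i , j)) χⱼ≢0) (indicator≢0⇒¬ (P? (i , j′)) χⱼ′≢0)
      i′≢i 2≤mi′

  -- In a settled position the unplayed vertices form a clique, whose hull cannot be everything;
  -- `another zero` merely exhibits a part with two vertices.
  move⇒unsettled : {P Q : Pred V 0ℓ} (P? : Decidable P) → TERMove G P Q → 2 ≤ maximum (remaining P?)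
  move⇒unsettled P? (universal , _) with maximum (remaining P?) ≤? 1 | another zero
  ... | no  M≰1 | _ = ≰⇒> M≰1
  ... | yes M≤1 | _ , _ , 2≤mi =
    contradiction universal (Clique⇒¬Hull-universal (settled⇒Clique P? M≤1) 2≤mi)

  -- Induction on the number `N` of unplayed vertices. Options are valued by their heap sizes;
  -- `HeapNim-avoids` keeps these values off `n`, and `HeapNim-reaches` attains every smaller one.
  HeapNim⇒HasNim : ∀ N {P : Pred V 0ℓ} (P? : Decidable P) (r : Star (TERMove G) ∅ P) →
                   sum (remaining P?) ≡ N → ∀ {n} → HeapNim (remaining P?) n → HasNim (TER G) (P , r) n
  HeapNim⇒HasNim N {P} P? r Σ≡N {n} ν = mexOptions (λ {q} → val {q}) (hasVal N Σ≡N) (n∉ , n≤)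
    where
    Γ = TER G
    open Game Γ using (_⟶_)

    after : V → Vector ℕ (suc k)
    after v = remaining (add? P? v)

    nim-after : ∀ v → ∃ (HeapNim (after v))
    nim-after v = nimValue (sum (after v)) (maximum (after v)) (spare (after v))

    val : ∀ {q} → (P , r) ⟶ q → ℕ
    val (_ , v , _) = proj₁ (nim-after v)

    hasVal : ∀ N → sum (remaining P?) ≡ N → ∀ {q} (o : (P , r) ⟶ q) → HasNim Γ q (val {q} o)
    hasVal zero    Σ≡0 (_ , v , v∉P , refl) =
      contradiction (trans (sym Σ≡0) (Removal-sum (remaining-Removal P? v∉P))) λ ()
    hasVal (suc N) Σ≡N {_ , r′} (_ , v , v∉P , refl) =
      HeapNim⇒HasNim N (add? P? v) r′
        (suc-injective (trans (sym (Removal-sum (remaining-Removal P? v∉P))) Σ≡N))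
        (proj₂ (nim-after v))

    n∉ : ¬ (∃[ q ] Σ[ o ∈ (P , r) ⟶ q ] val {q} o ≡ n)
    n∉ (q , o@(_ , v , v∉P , refl) , val≡n) =
      HeapNim-avoids (remaining-Removal P? v∉P) (move⇒unsettled P? o) ν (proj₂ (nim-after v)) val≡n

    n≤ : ∀ {j} → ¬ (∃[ q ] Σ[ o ∈ (P , r) ⟶ q ] val {q} o ≡ j) → n ≤ j
    n≤ {j} j∉ with n ≤? j
    ... | yes n≤j = n≤j
    ... | no  n≰j = contradiction attained j∉
      where
      attained : ∃[ q ] Σ[ o ∈ (P , r) ⟶ q ] val {q} o ≡ j
      attained with HeapNim-reaches (remaining P?) ν (≰⇒> n≰j)
      ... | i , rᵢ≢0 , reach with unplayed-vertex P? rᵢ≢0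
      -- A position carries the play leading to it from `∅`, which the move extends. `val` reports
      -- what `nimValue` computed and `reach` the value aimed at; uniqueness equates them.
      ...   | l , v∉P = (_ , r ◅◅ (move ◅ ε)) , move ,
        NimValue-unique (proj₂ (nim-after (i , l))) (reach (remaining-Removal P? v∉P))
        where
        move : TERMove G P (P ∪ ｛ i , l ｝)
        move = unsettled⇒Hull-universal P? (positive⇒unsettled ν (≰⇒> n≰j)) , (i , l) , v∉P , refl

-- From the part sizes to the starting heaps.

count≢0⇒∃ : ∀ {P : Pred ℕ 0ℓ} (P? : Decidable P) (m : Vector ℕ n) →
            1 ≤ Vec.count P? (Vec.tabulate m) → ∃[ i ] P (m i)
count≢0⇒∃ {n = suc n} P? m 1≤count with P? (m zero)
... | yes p = zero , p
... | no  _ with count≢0⇒∃ P? (tail m) 1≤count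
...   | i , p = suc i , p

-- Turns λ ≥ 2 into the form the game uses: whichever part is singled out, a nontrivial one remains
-- besides it.
count≥2⇒another : ∀ {P : Pred ℕ 0ℓ} (P? : Decidable P) (m : Vector ℕ n) →
                  2 ≤ Vec.count P? (Vec.tabulate m) → ∀ i → ∃[ i′ ] (i′ ≢ i × P (m i′))
count≥2⇒another {n = suc n} P? m 2≤count zero with P? (m zero)
... | yes _ with count≢0⇒∃ P? (tail m) (s≤s⁻¹ 2≤count)
...   | i , p = suc i , (λ ()) , p
count≥2⇒another {n = suc n} P? m 2≤count zero | no _ with count≢0⇒∃ P? (tail m) (<⇒≤ 2≤count)
...   | i , p = suc i , (λ ()) , p
count≥2⇒another {n = suc n} P? m 2≤count (suc i) with P? (m zero)
... | yes p = zero , (λ ()) , p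
... | no  _ with count≥2⇒another P? (tail m) 2≤count i
...   | i′ , i′≢i , p = suc i′ , i′≢i ∘ suc-injectiveᶠ , p

sum-const-1 : ∀ n → sum {n} (λ _ → 1) ≡ n
sum-const-1 zero    = refl
sum-const-1 (suc n) = cong suc (sum-const-1 n)

-- The counts at the start are sums of ones, which agree with the part sizes only pointwise.
HeapNim-cong : ∀ {u v : Vector ℕ k} {n} → (∀ i → u i ≡ v i) → HeapNim u n → HeapNim v n
HeapNim-cong {u = u} {v} {n} u≗v = subst₂ (λ T ME → NimValue T (proj₁ ME) (proj₂ ME) n)
  (sum-cong-≗ u≗v)
  (cong₂ _,_ M≡ (cong₂ (λ s M → s ∸ pred M) (sum-cong-≗ (cong pred ∘ u≗v)) M≡))
  where
  M≡ : maximum u ≡ maximum v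
  M≡ = ≤-antisym
    (maximum-least u λ i → ≤-trans (≤-reflexive (u≗v i)) (≤maximum v i))
    (maximum-least v λ i → ≤-trans (≤-reflexive (sym (u≗v i))) (≤maximum u i))

module _ (m : Vector ℕ (suc k)) (1≤head : 1 ≤ head m) (mono : Nondecreasing m) where

  maximum≡last : maximum m ≡ last m
  maximum≡last = ≤-antisym (maximum-least m λ i → mono (≤fromℕ i)) (≤maximum m (fromℕ k))

  -- The last part is a largest one, so its summand is exactly what `spare` subtracts.
  spare≡sum-init : spare m ≡ sum (pred ∘ init m)
  spare≡sum-init = trans
    (cong₂ _∸_ (sum-init-last (pred ∘ m)) (cong pred maximum≡last))
    (m+n∸n≡m (sum (pred ∘ init m)) (pred (last m)))

  -- Positive entries make the integer difference agree with `pred`.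
  sum-ℤ : (x : Vector ℕ n) → (∀ i → 1 ≤ x i) →
          ℤΣ.sum (λ i → + x i ℤ.- 1ℤ) ≡ + sum (pred ∘ x)
  sum-ℤ {n = zero}  x 1≤x = refl
  sum-ℤ {n = suc n} x 1≤x = cong₂ ℤ._+_ (pred-ℤ (1≤x zero)) (sum-ℤ (tail x) (1≤x ∘ suc))
    where
    pred-ℤ : ∀ {a} → 1 ≤ a → + a ℤ.- 1ℤ ≡ + pred a
    pred-ℤ (s≤s _) = refl

  -- This is d + E = M: adding E to a bound on d gives the additive form in `NimValue`.
  excess+spare : excess m ℤ.+ + spare m ≡ + maximum m
  excess+spare = begin
    excess m ℤ.+ + spare m                 ≡⟨ cong₂ (λ s e → (+ last m ℤ.- s) ℤ.+ + e) (sum-ℤ (init m) λ i → ≤-trans 1≤head (mono z≤n)) spare≡sum-init ⟩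
    + last m ℤ.- + e ℤ.+ + e               ≡⟨ ℤ.+-assoc (+ last m) (ℤ.- + e) (+ e) ⟩
    + last m ℤ.+ (ℤ.- + e ℤ.+ + e)         ≡⟨ cong (λ z → + last m ℤ.+ z) (ℤ.+-inverseˡ (+ e)) ⟩
    + last m ℤ.+ + 0                       ≡⟨ ℤ.+-identityʳ (+ last m) ⟩
    + last m                               ≡⟨ cong +_ maximum≡last ⟨
    + maximum m                            ∎
    where
    open ≡-Reasoning
    e = sum (pred ∘ init m)

  excess-≤ : ∀ t → excess m ≤ℤ + t → maximum m ≤ t + spare m
  excess-≤ t d≤t = ℤ.drop‿+≤+ (subst (_≤ℤ + (t + spare m)) excess+spare (ℤ.+-monoˡ-≤ (+ spare m) d≤t))

  excess-≥ : ∀ t → + t ≤ℤ excess m → t + spare m ≤ maximum m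
  excess-≥ t t≤d = ℤ.drop‿+≤+ (subst (+ (t + spare m) ≤ℤ_) excess+spare (ℤ.+-monoˡ-≤ (+ spare m) t≤d))

proposition5p15 : ∀ {k} (m : Vector ℕ (suc k)) →
    2 ≤ suc k →
    1 ≤ head m → Nondecreasing m → 2 ≤ last m →
    2 ≤ nontrivialParts m →
    let nim≡ = GameHasNim (TER (completeMultipartite m))
        |V|  = order m
        d    = excess m
    in (2 ∣ |V| → d ≤ℤ + 1 → nim≡ 0)
     × (2 ∣ |V| → + 2 ≤ℤ d → nim≡ 1)
     × (2 ∤ |V| → d ≤ℤ + 0 → nim≡ 1)
     × (2 ∤ |V| → d ≡ + 1 ⊎ d ≡ + 2 → nim≡ 2)
     × (2 ∤ |V| → + 3 ≤ℤ d → nim≡ 0)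
proposition5p15 {k} m _ 1≤head mono 2≤last 2≤λ =
    (λ 2∣V d≤1 → nim (even-low 2≤M 2∣V (upper 1 d≤1)))
  , (λ 2∣V 2≤d → nim (even-high 2≤M 2∣V (lower 2 2≤d)))
  , (λ 2∤V d≤0 → nim (odd-low 2≤M 2∤V (upper 0 d≤0)))
  -- Both values of d fall under `odd-mid`; d = 1 leaves its upper bound slack, d = 2 its lower one.
  , (λ 2∤V → λ where
      (inj₁ d≡1) → nim (odd-mid 2≤M 2∤V (lower 1 (ℤ.≤-reflexive (sym d≡1)))
                      (m≤n⇒m≤1+n (upper 1 (ℤ.≤-reflexive d≡1))))
      (inj₂ d≡2) → nim (odd-mid 2≤M 2∤V (<⇒≤ (lower 2 (ℤ.≤-reflexive (sym d≡2))))
                      (upper 2 (ℤ.≤-reflexive d≡2))))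
  , (λ 2∤V 3≤d → nim (odd-high 2≤M 2∤V (lower 3 3≤d)))
  where
  upper = excess-≤ m 1≤head mono
  lower = excess-≥ m 1≤head mono

  2≤M : 2 ≤ maximum m
  2≤M = ≤-trans 2≤last (≤maximum m (fromℕ k))

  nim : ∀ {n} → HeapNim m n → GameHasNim (TER (completeMultipartite m)) n
  nim ν = HeapNim⇒HasNim (count≥2⇒another (2 ≤?_) m 2≤λ) _ ∅? ε refl
    (HeapNim-cong (λ i → sym (sum-const-1 (m i))) ν)
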